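{- Let $G$ be a graph with $n\ge7$ vertices. Then $M[IAS(G)]$ has a transverse circuit of size $\le\frac{n}{2}$.
   Context: A graph is a finite looped simple graph; $A(G)$ is its $GF(2)$ adjacency matrix (diagonal 1 iff looped). $M[IAS(G)]$ is the binary matroid represented by $(I\;A(G)\;A(G)+I)$, with elements $\phi_G(v),\chi_G(v),\psi_G(v)$ (the $v$ columns of $I,A(G),A(G)+I$) and vertex triples $\tau_G(v)=\{\phi_G(v),\chi_G(v),\psi_G(v)\}$. A transversal is a subset of the ground set meeting every vertex triple exactly once; a transverse circuit is a circuit of $M[IAS(G)]$ contained in some transversal. -}

module Defs where

open import Data.Nat using (ℕ; zero; suc; _+_)
open import Data.Fin using (Fin; zero; suc; _≟_)
open import Data.Bool using (Bool; true; false; _∧_; _xor_; if_then_else_)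
open import Data.Product using (Σ; ∃; _×_; _,_)
open import Relation.Nullary using (¬_)
open import Relation.Nullary.Decidable using (isYes)
open import Relation.Binary.PropositionalEquality using (_≡_)

-- A finite looped simple graph on vertex set Fin n, given by its
-- GF(2) adjacency matrix (Bool = GF(2)); diagonal entry true iff looped.
record Graph (n : ℕ) : Set where
  field
    adj : Fin n → Fin n → Bool
    sym : ∀ i j → adj i j ≡ adj j i
open Graph public

-- The three kinds of elements in a vertex triple τ(v) = {φ(v), χ(v), ψ(v)}.
data Kind : Set where
  φ χ ψ : Kind

-- Ground set of M[IAS(G)] is Fin n × Kind; a subset is a Bool-valued predicate.
ElemSet : ℕ → Set
ElemSet n = Fin n → Kind → Bool

-- Column of the matrix (I  A(G)  A(G)+I) indexed by element (v , k), as a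
-- vector in GF(2)^n.
column : ∀ {n} → Graph n → Fin n → Kind → Fin n → Bool
column G v φ w = isYes (w ≟ v)
column G v χ w = adj G w v
column G v ψ w = adj G w v xor isYes (w ≟ v)

xorSum : ∀ {n} → (Fin n → Bool) → Bool
xorSum {zero} f = false
xorSum {suc n} f = f zero xor xorSum (λ i → f (suc i))

xorKinds : (Kind → Bool) → Bool
xorKinds f = f φ xor (f χ xor f ψ)

colSum : ∀ {n} → Graph n → ElemSet n → Fin n → Bool
colSum G S w = xorSum (λ v → xorKinds (λ k → S v k ∧ column G v k w))

natSum : ∀ {n} → (Fin n → ℕ) → ℕ
natSum {zero} f = 0
natSum {suc n} f = f zero + natSum (λ i → f (suc i))

size : ∀ {n} → ElemSet n → ℕ
size S = natSum (λ v → b2n (S v φ) + (b2n (S v χ) + b2n (S v ψ)))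
  where
  b2n : Bool → ℕ
  b2n b = if b then 1 else 0

_⊆_ : ∀ {n} → ElemSet n → ElemSet n → Set
S ⊆ T = ∀ v k → S v k ≡ true → T v k ≡ true

Nonempty : ∀ {n} → ElemSet n → Set
Nonempty S = ∃ λ v → ∃ λ k → S v k ≡ true

_⊂_ : ∀ {n} → ElemSet n → ElemSet n → Set
S ⊂ T = S ⊆ T × (∃ λ v → ∃ λ k → (T v k ≡ true) × (S v k ≡ false))

-- Dependent in M[IAS(G)]: the columns are linearly dependent over GF(2),
-- i.e. some nonempty subset of them sums to zero.
Dependent : ∀ {n} → Graph n → ElemSet n → Set
Dependent G S = ∃ λ T → T ⊆ S × Nonempty T × (∀ w → colSum G T w ≡ false)

Circuit : ∀ {n} → Graph n → ElemSet n → Set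
Circuit G C = Dependent G C × (∀ D → D ⊂ C → ¬ Dependent G D)

Transversal : ∀ {n} → ElemSet n → Set
Transversal {n} T = ∀ (v : Fin n) → ∃ λ k → (T v k ≡ true) × (∀ k' → T v k' ≡ true → k' ≡ k)

TransverseCircuit : ∀ {n} → Graph n → ElemSet n → Set
TransverseCircuit G C = Circuit G C × (∃ λ T → Transversal T × C ⊆ T)

{-# OPTIONS --safe #-}
module Submission where

-- A set of elements of M[IAS(G)] with at most one element in each vertex
-- triple sums to zero exactly when, for some x in GF(2)^n, its trace on each
-- triple τ(v) is given by the letter (x v , (A x) v), where (0,1), (1,0),
-- (1,1) stand for φ(v), χ(v), ψ(v) and (0,0) for the empty set.  These words form an additive code that is
-- self-orthogonal for the symplectic form because A is symmetric, and a
-- nonzero word of least weight is a transverse circuit.  Suppose that all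
-- nonzero words have weight > n/2.
--
-- n = 2m: take distinct a, b, c₀, …, c₃ and m - 2 further vertices R.
-- Counting equations gives for each i a nonzero word vanishing on R and cᵢ
-- with first coordinate 0 at a; it is nonzero at all other vertices outside
-- R, so at a it has the letter (0,1).  Two of the four agree at b, and their
-- sum is a nonzero word vanishing on the m vertices a, b and R.
--
-- n = 2m + 1: each m-set R is the zero set of a nonzero word, of weight m + 1,
-- and this word is unique by duality.  By self-orthogonality the parity of
-- the weight is additive.  If |R| = m - 1, two of the words vanishing on R
-- and on cᵢ (i < 4) agree at a, so their sum also has weight m + 1, and m + 1
-- is even.  Words of weight m + 1 produce every letter at a, so the zero set
-- of any word can be enlarged by adding even words; hence all words are even.
-- But the word of x = (1, …, 1) has odd weight n.

open import Defs renaming (sym to adj-sym)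
open import Data.Bool using (Bool; true; false; not; _∧_; _∨_; _xor_; if_then_else_)
import Data.Bool.Properties as 𝔹
open import Data.Empty using (⊥; ⊥-elim)
open import Data.Fin using (Fin; zero; suc; _≟_; #_; finToFun; funToFin; combine)
open import Data.Fin.Properties using (any?; 2↔Bool; pigeonhole; injective⇒≤; ¬∀⟶∃¬; finToFun-funToFin; funToFin-finToFin; suc-injective; <⇒≢)
open import Data.Fin.Subset.Properties using (anySubset?)
open import Data.List using (List; []; _∷_; _++_; length; lookup; filter; tabulate; allFin)
open import Data.List.Properties using (length-++; ++-identityʳ)
import Data.List.Membership.DecPropositional as DecMembership
open import Data.List.Membership.Propositional using (_∈_; _∉_)
open import Data.List.Membership.Propositional.Properties using (∈-lookup; ∈-filter⁻; ∈-++⁻; ∈-++⁺ˡ; ∈-++⁺ʳ)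
open import Data.List.Relation.Unary.All as All using (All; []; _∷_)
open import Data.List.Relation.Unary.All.Properties using (¬Any⇒All¬; ++⁻ˡ; ++⁻ʳ)
open import Data.List.Relation.Unary.AllPairs using ([]; _∷_; tail)
open import Data.List.Relation.Unary.Any using (here; there; index)
open import Data.List.Relation.Unary.Any.Properties using (lookup-index)
open import Data.List.Relation.Unary.Unique.Propositional using (Unique)
open import Data.List.Relation.Unary.Unique.Propositional.Properties using (++⁺; filter⁺; allFin⁺; Unique[x∷xs]⇒x∉xs)
open import Data.Bool.Solver using (module xor-∧-Solver)
open import Data.Nat using (ℕ; zero; suc; _+_; _*_; _^_; _≤_; _<_; z≤n; s≤s; s≤s⁻¹; _≤?_; _<?_; pred)
open import Data.Nat.Induction using (<-wellFounded)
open import Data.Nat.Tactic.RingSolver using (solve-∀)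
open import Data.Nat.Properties using (module ≤-Reasoning; ≤-refl; ≤-reflexive; ≤-trans; <-≤-trans; ≤-<-trans; <-irrefl; ≤-antisym; ≰⇒>; ≮⇒≥; <⇒≤; m≤m+n; m≤n+m; +-comm; +-suc; +-identityʳ; *-suc; *-distribˡ-+; *-monoʳ-≤; +-mono-<-≤; +-mono-≤; +-mono-≤-<; +-monoʳ-≤; +-cancelʳ-≤; *-cancelˡ-<; *-cancelˡ-≤; ^-monoʳ-<)
open import Data.Product using (∃; ∃₂; _×_; _,_; proj₁; proj₂)
open import Data.Product.Properties using (≡-dec)
open import Data.Sum using (_⊎_; inj₁; inj₂)
import Data.Vec as Vec
import Data.Vec.Properties as Vec
open import Function using (_∘_; id; Inverse; Injective)
open import Induction.WellFounded using (Acc; acc)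
open import Relation.Binary.Definitions using (DecidableEquality)
open import Relation.Binary.PropositionalEquality using (_≡_; _≢_; _≗_; refl; sym; trans; cong; cong₂; subst; module ≡-Reasoning)
open import Relation.Nullary using (¬_; Dec; yes; no; contradiction; ¬?; _×-dec_; _⊎-dec_; _→-dec_)
open import Relation.Nullary.Decidable using (from-yes; map′; decidable-stable; isYes)
open import Relation.Unary using (Decidable)

-- Sums over Fin n

xorSum-cong : ∀ {n} {f g : Fin n → Bool} → f ≗ g → xorSum f ≡ xorSum g
xorSum-cong {zero}  f≗g = refl
xorSum-cong {suc n} f≗g = cong₂ _xor_ (f≗g zero) (xorSum-cong (f≗g ∘ suc))

xorSum-false : ∀ n → xorSum {n} (λ _ → false) ≡ false
xorSum-false zero    = refl
xorSum-false (suc n) = xorSum-false n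

xor-interchange : ∀ a b c d → (a xor b) xor (c xor d) ≡ (a xor c) xor (b xor d)
xor-interchange false false c d = refl
xor-interchange false true  c d = 𝔹.not-distribʳ-xor c d
xor-interchange true  false c d = 𝔹.not-distribˡ-xor c d
xor-interchange true  true  c d = sym (𝔹.xor-annihilates-not c d)

xorSum-xor : ∀ {n} (f g : Fin n → Bool) → xorSum (λ i → f i xor g i) ≡ xorSum f xor xorSum g
xorSum-xor {zero}  f g = refl
xorSum-xor {suc n} f g = trans
  (cong ((f zero xor g zero) xor_) (xorSum-xor (f ∘ suc) (g ∘ suc)))
  (xor-interchange (f zero) (g zero) _ _)

xorSum-∧ˡ : ∀ {n} b (f : Fin n → Bool) → xorSum (λ i → b ∧ f i) ≡ b ∧ xorSum f
xorSum-∧ˡ {n} false f = xorSum-false n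
xorSum-∧ˡ     true  f = refl

xorSum-swap : ∀ {m n} (f : Fin m → Fin n → Bool) →
  xorSum (λ i → xorSum (f i)) ≡ xorSum (λ j → xorSum (λ i → f i j))
xorSum-swap {zero}  {n} f = sym (xorSum-false n)
xorSum-swap {suc m} f = trans
  (cong (xorSum (f zero) xor_) (xorSum-swap (f ∘ suc)))
  (sym (xorSum-xor (f zero) _))

xorSum-single : ∀ {n} (f : Fin n → Bool) j → (∀ i → i ≢ j → f i ≡ false) → xorSum f ≡ f j
xorSum-single {suc n} f zero off = trans
  (cong (f zero xor_) (trans (xorSum-cong (λ i → off (suc i) λ ())) (xorSum-false n)))
  (𝔹.xor-identityʳ (f zero))
xorSum-single f (suc j) off = trans
  (cong (_xor xorSum (f ∘ suc)) (off zero λ ()))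
  (xorSum-single (f ∘ suc) j (λ i i≢j → off (suc i) (i≢j ∘ suc-injective)))

natSum-cong : ∀ {n} {f g : Fin n → ℕ} → f ≗ g → natSum f ≡ natSum g
natSum-cong {zero}  f≗g = refl
natSum-cong {suc n} f≗g = cong₂ _+_ (f≗g zero) (natSum-cong (f≗g ∘ suc))

natSum-mono-≤ : ∀ {n} {f g : Fin n → ℕ} → (∀ i → f i ≤ g i) → natSum f ≤ natSum g
natSum-mono-≤ {zero}  f≤g = z≤n
natSum-mono-≤ {suc n} f≤g = +-mono-≤ (f≤g zero) (natSum-mono-≤ (f≤g ∘ suc))

natSum-mono-< : ∀ {n} {f g : Fin n → ℕ} → (∀ i → f i ≤ g i) → ∀ j → f j < g j → natSum f < natSum g
natSum-mono-< f≤g zero    f<g = +-mono-<-≤ f<g (natSum-mono-≤ (f≤g ∘ suc))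
natSum-mono-< f≤g (suc j) f<g = +-mono-≤-< (f≤g zero) (natSum-mono-< (f≤g ∘ suc) j f<g)

bit : Bool → ℕ
bit b = if b then 1 else 0

odd : ℕ → Bool
odd zero    = false
odd (suc n) = not (odd n)

odd-natSum : ∀ {n} (f : Fin n → Bool) → odd (natSum (bit ∘ f)) ≡ xorSum f
odd-natSum {zero}  f = refl
odd-natSum {suc n} f with f zero
... | false = odd-natSum (f ∘ suc)
... | true  = cong not (odd-natSum (f ∘ suc))

xorSum-true : ∀ n → xorSum {n} (λ _ → true) ≡ odd n
xorSum-true zero    = refl
xorSum-true (suc n) = cong not (xorSum-true n)

odd-double : ∀ m → odd (2 * m) ≡ false
odd-double zero    = refl
odd-double (suc m) = trans (cong odd (*-suc 2 m)) (trans (𝔹.not-involutive _) (odd-double m))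

even-or-odd : ∀ n → (∃ λ m → n ≡ 2 * m) ⊎ (∃ λ m → n ≡ suc (2 * m))
even-or-odd zero    = inj₁ (0 , refl)
even-or-odd (suc n) with even-or-odd n
... | inj₁ (m , eq) = inj₂ (m , cong suc eq)
... | inj₂ (m , eq) = inj₁ (suc m , trans (cong suc eq) (sym (*-suc 2 m)))

length-filter-tabulate : ∀ {n} {A : Set} (b : A → Bool) (g : Fin n → A) →
  length (filter (λ a → b a 𝔹.≟ true) (tabulate g)) ≡ natSum (bit ∘ b ∘ g)
length-filter-tabulate {zero}  b g = refl
length-filter-tabulate {suc n} b g with b (g zero)
... | false = length-filter-tabulate b (g ∘ suc)
... | true  = cong suc (length-filter-tabulate b (g ∘ suc))

-- Duplicate-free lists of vertices

module _ {A : Set} where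

  unique-∷ : ∀ {v : A} {R} → v ∉ R → Unique R → Unique (v ∷ R)
  unique-∷ v∉R u = ¬Any⇒All¬ _ v∉R ∷ u

  unique-++⁻ˡ : ∀ (E : List A) {R} → Unique (E ++ R) → Unique E
  unique-++⁻ˡ []      u       = []
  unique-++⁻ˡ (_ ∷ E) (p ∷ u) = ++⁻ˡ E p ∷ unique-++⁻ˡ E u

  lookup-∉ : ∀ (E : List A) {R} → Unique (E ++ R) → ∀ i → lookup E i ∉ R
  lookup-∉ (v ∷ E) u       zero    v∈R = Unique[x∷xs]⇒x∉xs u (∈-++⁺ʳ E v∈R)
  lookup-∉ (_ ∷ E) (_ ∷ u) (suc i)     = lookup-∉ E u i

  lookup-injective : ∀ (E : List A) {R} → Unique (E ++ R) → Injective _≡_ _≡_ (lookup E)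
  lookup-injective (v ∷ E) u       {zero}  {zero}  eq = refl
  lookup-injective (v ∷ E) u       {zero}  {suc j} refl =
    ⊥-elim (Unique[x∷xs]⇒x∉xs u (∈-++⁺ˡ (∈-lookup {xs = E} j)))
  lookup-injective (v ∷ E) u       {suc i} {zero}  refl =
    ⊥-elim (Unique[x∷xs]⇒x∉xs u (∈-++⁺ˡ (∈-lookup {xs = E} i)))
  lookup-injective (v ∷ E) (_ ∷ u) {suc i} {suc j} eq = cong suc (lookup-injective E u eq)

module _ {n : ℕ} where

  open DecMembership (_≟_ {n}) using (_∈?_)

  length-unique : ∀ {R : List (Fin n)} → Unique R → length R ≤ n
  length-unique {R} u = injective⇒≤ (lookup-injective R {[]} (subst Unique (sym (++-identityʳ R)) u))

  unique-complete : ∀ {R : List (Fin n)} → Unique R → n ≤ length R → ∀ v → v ∈ R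
  unique-complete {R} u n≤ v = decidable-stable (v ∈? R)
    λ v∉R → <-irrefl refl (≤-<-trans n≤ (length-unique (unique-∷ v∉R u)))

  fresh : ∀ (R : List (Fin n)) → length R < n → ∃ λ v → v ∉ R
  fresh R l<n with any? (λ v → ¬? (v ∈? R))
  ... | yes new = new
  ... | no ¬new = ⊥-elim (<-irrefl refl (<-≤-trans l<n (injective⇒≤ index-injective)))
    where
    mem : ∀ v → v ∈ R
    mem v = decidable-stable (v ∈? R) λ v∉R → ¬new (v , v∉R)
    index-injective : Injective _≡_ _≡_ (λ v → index (mem v))
    index-injective {v} {w} eq =
      trans (lookup-index (mem v)) (trans (cong (lookup R) eq) (sym (lookup-index (mem w))))

  abstract

    extend : ∀ k {R : List (Fin n)} → Unique R → k + length R ≤ n →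
      ∃ λ E → length E ≡ k × Unique (E ++ R)
    extend zero    u _ = [] , refl , u
    extend (suc k) {R} u k+l<n with extend k u (≤-trans (m≤n+m _ 1) k+l<n)
    ... | E , refl , u′ with fresh (E ++ R) (≤-trans (s≤s (≤-reflexive (length-++ E))) k+l<n)
    ... | v , v∉ = v ∷ E , refl , unique-∷ v∉ u′

    -- Freshness is given pairwise because that is how it is used: a word vanishing on `p j ∷ R` is
    -- examined at the further vertex `p i`.
    frame : ∀ k {R : List (Fin n)} → Unique R → k + length R ≤ n →
      ∃ λ (p : Fin k → Fin n) → ∀ {i j} → i ≢ j → Unique (p i ∷ p j ∷ R)
    frame k u k+l≤n with extend k u k+l≤n
    ... | E , refl , u′ = lookup E , λ {i} {j} i≢j → unique-∷
      (λ { (here eq) → i≢j (lookup-injective E u′ eq) ; (there ∈R) → lookup-∉ E u′ i ∈R })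
      (unique-∷ (lookup-∉ E u′ j) u)

-- Linear algebra over GF(2)

Vector : ℕ → Set
Vector n = Fin n → Bool

_⊞_ : ∀ {n} → Vector n → Vector n → Vector n
(x ⊞ y) v = x v xor y v

Additive : ∀ {n} → (Vector n → Bool) → Set
Additive f = ∀ x y → f (x ⊞ y) ≡ f x xor f y

funToFin-cong : ∀ {m n} {f g : Fin m → Fin n} → f ≗ g → funToFin f ≡ funToFin g
funToFin-cong {zero}  f≗g = refl
funToFin-cong {suc m} f≗g = cong₂ combine (f≗g zero) (funToFin-cong (f≗g ∘ suc))

≢⇒xor : ∀ {a b} → a ≢ b → a xor b ≡ true
≢⇒xor {false} {false} a≢b = contradiction refl a≢b
≢⇒xor {false} {true}  a≢b = refl
≢⇒xor {true}  {false} a≢b = refl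
≢⇒xor {true}  {true}  a≢b = contradiction refl a≢b

≡⇒xor : ∀ {a b} → a ≡ b → a xor b ≡ false
≡⇒xor {a} refl = 𝔹.xor-same a

module _ {n : ℕ} where

  open Inverse 2↔Bool using (to; from; strictlyInverseˡ; strictlyInverseʳ)

  vector : Fin (2 ^ n) → Vector n
  vector i = to ∘ finToFun i

  vector-injective : ∀ {i j} → vector i ≗ vector j → i ≡ j
  vector-injective {i} {j} eq = begin
    i                              ≡⟨ funToFin-finToFin {n} {2} i ⟨
    funToFin (finToFun {2} {n} i)  ≡⟨ funToFin-cong (λ v → trans (sym (strictlyInverseʳ (finToFun i v)))
                                        (trans (cong from (eq v)) (strictlyInverseʳ (finToFun j v)))) ⟩
    funToFin (finToFun {2} {n} j)  ≡⟨ funToFin-finToFin {n} {2} j ⟩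
    j                              ∎
    where open ≡-Reasoning

  values : (fs : List (Vector n → Bool)) → Vector n → Fin (2 ^ length fs)
  values fs x = funToFin (λ l → from (lookup fs l x))

  values-agree : ∀ fs x y → values fs x ≡ values fs y → ∀ l → lookup fs l x ≡ lookup fs l y
  values-agree fs x y eq l = begin
    lookup fs l x                ≡⟨ strictlyInverseˡ _ ⟨
    to (from (lookup fs l x))    ≡⟨ cong to (finToFun-funToFin _ l) ⟨
    to (finToFun (values fs x) l) ≡⟨ cong (λ k → to (finToFun k l)) eq ⟩
    to (finToFun (values fs y) l) ≡⟨ cong to (finToFun-funToFin _ l) ⟩
    to (from (lookup fs l y))    ≡⟨ strictlyInverseˡ _ ⟩
    lookup fs l y                ∎
    where open ≡-Reasoning

  abstract

    -- There are more vectors than values of fs, so two vectors have the same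
    -- values; their sum is in the kernel.
    kernel : (fs : List (Vector n → Bool)) → All Additive fs → length fs < n →
      ∃ λ x → (∃ λ v → x v ≡ true) × All (λ f → f x ≡ false) fs
    kernel fs additive l<n with pigeonhole (^-monoʳ-< 2 ≤-refl l<n) (values fs ∘ vector)
    ... | i , j , i<j , eq
      with ¬∀⟶∃¬ n _ (λ v → vector i v 𝔹.≟ vector j v) (<⇒≢ i<j ∘ vector-injective)
    ... | v , differ = vector i ⊞ vector j , (v , ≢⇒xor differ) , All.tabulate λ {f} f∈ →
      trans (All.lookup additive f∈ (vector i) (vector j)) (≡⇒xor
        (subst (λ g → g (vector i) ≡ g (vector j)) (sym (lookup-index f∈))
          (values-agree fs (vector i) (vector j) eq (index f∈))))

-- Letters: the additive group of GF(4) with its symplectic form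

Letter : Set
Letter = Bool × Bool

pattern 𝟎 = (false , false)

_⊕_ : Letter → Letter → Letter
(a , b) ⊕ (c , d) = (a xor c) , (b xor d)

ω : Letter → Letter → Bool
ω (a , b) (c , d) = (a ∧ d) xor (b ∧ c)

nonzero : Letter → Bool
nonzero (a , b) = a ∨ b

_≟ₗ_ : DecidableEquality Letter
_≟ₗ_ = ≡-dec 𝔹._≟_ 𝔹._≟_

-- With only four letters, decidable identities and implications between letters are proved by
-- evaluation through `from-yes`.
allLetters? : {P : Letter → Set} → Decidable P → Dec (∀ p → P p)
allLetters? P? = map′
  (λ { (p₀ , p₁ , p₂ , p₃) → λ { (false , false) → p₀ ; (false , true) → p₁ ; (true , false) → p₂ ; (true , true) → p₃ } })
  (λ p → p _ , p _ , p _ , p _)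
  (P? (false , false) ×-dec P? (false , true) ×-dec P? (true , false) ×-dec P? (true , true))

nonzero-true : ∀ p → p ≢ 𝟎 → nonzero p ≡ true
nonzero-true = from-yes (allLetters? λ p → ¬? (p ≟ₗ 𝟎) →-dec nonzero p 𝔹.≟ true)

⊕-𝟎⇒≡ : ∀ p q → p ⊕ q ≡ 𝟎 → p ≡ q
⊕-𝟎⇒≡ = from-yes (allLetters? λ p → allLetters? λ q → (p ⊕ q) ≟ₗ 𝟎 →-dec p ≟ₗ q)

⊕-self : ∀ p → p ⊕ p ≡ 𝟎
⊕-self (a , b) = cong₂ _,_ (𝔹.xor-same a) (𝔹.xor-same b)

⊕-cancelˡ : ∀ p q r → p ⊕ q ≡ p ⊕ r → q ≡ r
⊕-cancelˡ = from-yes (allLetters? λ p → allLetters? λ q → allLetters? λ r →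
  (p ⊕ q) ≟ₗ (p ⊕ r) →-dec q ≟ₗ r)

-- The indicator `nonzero` is the quadratic form a + b + ab over GF(2), and `ω` is its polar form.
nonzero-⊕ : ∀ p q → nonzero (p ⊕ q) ≡ (nonzero p xor nonzero q) xor ω p q
nonzero-⊕ = from-yes (allLetters? λ p → allLetters? λ q →
  nonzero (p ⊕ q) 𝔹.≟ ((nonzero p xor nonzero q) xor ω p q))

ω-𝟎ʳ : ∀ p → ω p 𝟎 ≡ false
ω-𝟎ʳ = from-yes (allLetters? λ p → ω p 𝟎 𝔹.≟ false)

-- In a symplectic plane over GF(2) the orthogonal complement of a nonzero letter p is its span {𝟎,
-- p}.
commuting⇒≡ : ∀ p q → ω p q ≡ false → p ≢ 𝟎 → q ≢ 𝟎 → p ≡ q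
commuting⇒≡ = from-yes (allLetters? λ p → allLetters? λ q →
  ω p q 𝔹.≟ false →-dec ¬? (p ≟ₗ 𝟎) →-dec ¬? (q ≟ₗ 𝟎) →-dec p ≟ₗ q)

second-nonzero : ∀ p → p ≢ 𝟎 → proj₁ p ≡ false → p ≡ (false , true)
second-nonzero = from-yes (allLetters? λ p →
  ¬? (p ≟ₗ 𝟎) →-dec proj₁ p 𝔹.≟ false →-dec p ≟ₗ (false , true))

spanning : ∀ p q → p ≢ 𝟎 → q ≢ 𝟎 → p ≢ q → ∀ r → r ≡ 𝟎 ⊎ r ≡ p ⊎ r ≡ q ⊎ r ≡ p ⊕ q
spanning = from-yes (allLetters? λ p → allLetters? λ q →
  ¬? (p ≟ₗ 𝟎) →-dec ¬? (q ≟ₗ 𝟎) →-dec ¬? (p ≟ₗ q) →-dec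
  allLetters? λ r → r ≟ₗ 𝟎 ⊎-dec r ≟ₗ p ⊎-dec r ≟ₗ q ⊎-dec r ≟ₗ (p ⊕ q))

-- Junk value at 𝟎; injective on the other three letters.
code : Letter → Fin 3
code (true  , true)  = suc (suc zero)
code (true  , false) = suc zero
code (false , _)     = zero

code-injective : ∀ p q → p ≢ 𝟎 → q ≢ 𝟎 → code p ≡ code q → p ≡ q
code-injective = from-yes (allLetters? λ p → allLetters? λ q →
  ¬? (p ≟ₗ 𝟎) →-dec ¬? (q ≟ₗ 𝟎) →-dec code p ≟ code q →-dec p ≟ₗ q)

abstract

  four-nonzero-letters : ∀ (f : Fin 4 → Letter) → (∀ i → f i ≢ 𝟎) → ∃₂ λ i j → i ≢ j × f i ≡ f j
  four-nonzero-letters f f≢𝟎 with pigeonhole ≤-refl (code ∘ f)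
  ... | i , j , i<j , eq = i , j , <⇒≢ i<j , code-injective (f i) (f j) (f≢𝟎 i) (f≢𝟎 j) eq

-- The self-dual additive code of a graph

module Code {n : ℕ} (G : Graph n) where

  _·_ : Fin n → Vector n → Bool
  w · x = xorSum (λ v → x v ∧ adj G w v)

  letter : Vector n → Fin n → Letter
  letter x v = x v , v · x

  NonZero : Vector n → Set
  NonZero x = ∃ λ v → letter x v ≢ 𝟎

  nonZero? : Decidable NonZero
  nonZero? x = any? (λ v → ¬? (letter x v ≟ₗ 𝟎))

  VanishesOn : List (Fin n) → Vector n → Set
  VanishesOn R x = All (λ v → letter x v ≡ 𝟎) R

  wt : Vector n → ℕ
  wt x = natSum (λ v → bit (nonzero (letter x v)))

  parity : Vector n → Bool
  parity x = xorSum (λ v → nonzero (letter x v))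

  letter-cong : ∀ {x y} → x ≗ y → letter x ≗ letter y
  letter-cong x≗y v = cong₂ _,_ (x≗y v) (xorSum-cong (λ w → cong (_∧ adj G v w) (x≗y w)))

  ·-additive : ∀ w → Additive (w ·_)
  ·-additive w x y = trans
    (xorSum-cong (λ v → 𝔹.∧-distribʳ-xor (adj G w v) (x v) (y v)))
    (xorSum-xor (λ v → x v ∧ adj G w v) _)

  letter-⊞ : ∀ x y v → letter (x ⊞ y) v ≡ letter x v ⊕ letter y v
  letter-⊞ x y v = cong ((x v xor y v) ,_) (·-additive v x y)

  -- The two halves of `ω` sum to the bilinear values xᵀAy and yᵀAx, which are equal because A is
  -- symmetric, and so cancel.
  self-orthogonal : ∀ x y → xorSum (λ v → ω (letter x v) (letter y v)) ≡ false
  self-orthogonal x y = trans (xorSum-xor (λ v → x v ∧ v · y) (λ v → v · x ∧ y v)) (≡⇒xor (begin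
    xorSum (λ v → x v ∧ v · y)
      ≡⟨ xorSum-cong (λ v → sym (xorSum-∧ˡ (x v) (λ w → y w ∧ adj G v w))) ⟩
    xorSum (λ v → xorSum (λ w → x v ∧ (y w ∧ adj G v w)))
      ≡⟨ xorSum-swap (λ v w → x v ∧ (y w ∧ adj G v w)) ⟩
    xorSum (λ w → xorSum (λ v → x v ∧ (y w ∧ adj G v w)))
      ≡⟨ xorSum-cong (λ w → xorSum-cong (λ v → exchange (x v) (y w) (adj-sym G v w))) ⟩
    xorSum (λ w → xorSum (λ v → y w ∧ (x v ∧ adj G w v)))
      ≡⟨ xorSum-cong (λ w → trans (xorSum-∧ˡ (y w) (λ v → x v ∧ adj G w v)) (𝔹.∧-comm (y w) _)) ⟩
    xorSum (λ w → w · x ∧ y w) ∎))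
    where
    open ≡-Reasoning
    exchange : ∀ a b {c d} → c ≡ d → a ∧ (b ∧ c) ≡ b ∧ (a ∧ d)
    exchange true  true  eq = eq
    exchange true  false eq = refl
    exchange false true  eq = refl
    exchange false false eq = refl

  -- The failure of `nonzero` to be additive at a vertex is a value of `ω`, and these values sum to
  -- zero by self-orthogonality.
  parity-⊞ : ∀ x y → parity (x ⊞ y) ≡ parity x xor parity y
  parity-⊞ x y = begin
    parity (x ⊞ y)
      ≡⟨ xorSum-cong (λ v → trans (cong nonzero (letter-⊞ x y v)) (nonzero-⊕ (letter x v) (letter y v))) ⟩
    xorSum (λ v → (nonzero (letter x v) xor nonzero (letter y v)) xor ω (letter x v) (letter y v))
      ≡⟨ xorSum-xor (λ v → nonzero (letter x v) xor nonzero (letter y v)) _ ⟩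
    xorSum (λ v → nonzero (letter x v) xor nonzero (letter y v)) xor xorSum (λ v → ω (letter x v) (letter y v))
      ≡⟨ cong₂ _xor_ (xorSum-xor (λ v → nonzero (letter x v)) _) (self-orthogonal x y) ⟩
    (parity x xor parity y) xor false
      ≡⟨ 𝔹.xor-identityʳ _ ⟩
    parity x xor parity y ∎
    where open ≡-Reasoning

  parity-zero : ∀ {x} → ¬ NonZero x → parity x ≡ false
  parity-zero {x} x≡0 = trans
    (xorSum-cong (λ v → cong nonzero (decidable-stable (letter x v ≟ₗ 𝟎) λ ≢𝟎 → x≡0 (v , ≢𝟎))))
    (xorSum-false n)

  vanishes-⊞ : ∀ x y {R} → VanishesOn R x → VanishesOn R y → VanishesOn R (x ⊞ y)
  vanishes-⊞ x y xs ys = All.map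
    (λ { {v} (p , q) → trans (letter-⊞ x y v) (cong₂ _⊕_ p q) }) (All.zip (xs , ys))

  letters-agree : ∀ x y {v} → letter x v ≡ letter y v → letter (x ⊞ y) v ≡ 𝟎
  letters-agree x y {v} eq =
    trans (letter-⊞ x y v) (trans (cong (letter x v ⊕_) (sym eq)) (⊕-self (letter x v)))

  letters-differ : ∀ x y {v} → letter x v ≢ letter y v → NonZero (x ⊞ y)
  letters-differ x y {v} differ = v , λ eq → differ (⊕-𝟎⇒≡ _ _ (trans (sym (letter-⊞ x y v)) eq))

  wt+length≤n : ∀ {R x} → Unique R → VanishesOn R x → wt x + length R ≤ n
  wt+length≤n {R} {x} u x⊥R = ≤-trans (≤-reflexive (sym (trans (length-++ support) (cong (_+ length R)
    (length-filter-tabulate (λ v → nonzero (letter x v)) id)))))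
    (length-unique (++⁺ (filter⁺ _ (allFin⁺ n)) u disjoint))
    where
    support = filter (λ v → nonzero (letter x v) 𝔹.≟ true) (allFin n)
    disjoint : ∀ {v} → ¬ (v ∈ support × v ∈ R)
    disjoint (v∈s , v∈R) with () ←
      trans (sym (proj₂ (∈-filter⁻ _ {xs = allFin n} v∈s))) (cong nonzero (All.lookup x⊥R v∈R))

  -- Linear functionals whose common kernel consists of the words vanishing on the list: two
  -- equations for each vertex.
  checks : List (Fin n) → List (Vector n → Bool)
  checks []      = []
  checks (v ∷ R) = (λ x → x v) ∷ (v ·_) ∷ checks R

  length-checks : ∀ R → length (checks R) ≡ 2 * length R
  length-checks []      = refl
  length-checks (v ∷ R) = trans (cong (2 +_) (length-checks R)) (sym (*-suc 2 (length R)))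

  checks-additive : ∀ R → All Additive (checks R)
  checks-additive []      = []
  checks-additive (v ∷ R) = (λ x y → refl) ∷ ·-additive v ∷ checks-additive R

  checks-vanish : ∀ R {x} → All (λ f → f x ≡ false) (checks R) → VanishesOn R x
  checks-vanish []      _             = []
  checks-vanish (v ∷ R) (p ∷ q ∷ rest) = cong₂ _,_ p q ∷ checks-vanish R rest

  vanishing-word : ∀ R → 2 * length R < n → ∃ λ x → NonZero x × VanishesOn R x
  vanishing-word R l<n
    with kernel (checks R) (checks-additive R) (≤-trans (s≤s (≤-reflexive (length-checks R))) l<n)
  ... | x , (v , xv) , zs = x , (v , λ eq → contradiction (trans (sym xv) (cong proj₁ eq)) λ ()) , checks-vanish R zs

  vanishing-word-at : ∀ a R → suc (2 * length R) < n →
    ∃ λ x → NonZero x × VanishesOn R x × x a ≡ false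
  vanishing-word-at a R l<n
    with kernel ((λ x → x a) ∷ checks R) ((λ x y → refl) ∷ checks-additive R)
           (≤-trans (s≤s (s≤s (≤-reflexive (length-checks R)))) l<n)
  ... | x , (v , xv) , z ∷ zs =
    x , (v , λ eq → contradiction (trans (sym xv) (cong proj₁ eq)) λ ()) , checks-vanish R zs , z

-- Graphs all of whose nonzero words have weight above n/2

module Heavy {n : ℕ} (G : Graph n) (heavy : ∀ x → Code.NonZero G x → n < 2 * Code.wt G x) where

  open Code G

  -- A further zero at v would give at least n/2 zeros, leaving weight at most n/2.
  nonvanishing : ∀ {R x v} → Unique (v ∷ R) → NonZero x → VanishesOn R x → n ≤ 2 * suc (length R) →
    letter x v ≢ 𝟎
  nonvanishing {R} {x} {v} u x≢0 x⊥R n≤ eq = <-irrefl refl (begin-strict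
    n + n                            <⟨ +-mono-<-≤ (heavy x x≢0) n≤ ⟩
    2 * wt x + 2 * length (v ∷ R)    ≡⟨ *-distribˡ-+ 2 (wt x) (length (v ∷ R)) ⟨
    2 * (wt x + length (v ∷ R))      ≤⟨ *-monoʳ-≤ 2 (wt+length≤n u (eq ∷ x⊥R)) ⟩
    2 * n                            ≡⟨ cong (n +_) (+-identityʳ n) ⟩
    n + n                            ∎)
    where open ≤-Reasoning

  distinct-vertices : ∀ k → k ≤ n → ∃ λ R → length R ≡ k × Unique R
  distinct-vertices k k≤n with extend k [] (≤-trans (≤-reflexive (+-identityʳ k)) k≤n)
  ... | R , len , u = R , len , subst Unique (++-identityʳ R) u

  even-impossible : ∀ {R} → Unique R → n ≡ 2 * (2 + length R) → 2 ≤ length R → ⊥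
  even-impossible {R} u n≡ 2≤l =
    -- The sum vanishes on `p b ∷ R`, so it cannot vanish at `p a`; yet both words have the letter
    -- (0,1) there.
    nonvanishing {x = w i ⊞ w j} (pair {a} {b} λ ()) (letters-differ (w i) (w j) distinct)
      (letters-agree (w i) (w j) at-b ∷ vanishes-⊞ (w i) (w j) (w⊥R i) (w⊥R j)) n≤
      (letters-agree (w i) (w j) (trans (at-a i) (sym (at-a j))))
    where
    open ≤-Reasoning
    n≤ : n ≤ 2 * (2 + length R)
    n≤ = ≤-reflexive n≡
    -- Exactly 4 + |R| vertices lie outside R, so |R| ≥ 2 leaves room for a, b and the four c's.
    room : 6 + length R ≤ n
    room = begin
      6 + length R            ≡⟨ cong (4 +_) (+-comm 2 (length R)) ⟩
      4 + (length R + 2)      ≤⟨ +-monoʳ-≤ (4 + length R) 2≤l ⟩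
      4 + (length R + length R) ≡⟨ double (length R) ⟩
      2 * (2 + length R)      ≡⟨ n≡ ⟨
      n                       ∎
      where
      double : ∀ l → 4 + (l + l) ≡ 2 * (2 + l)
      double = solve-∀
    framed = frame 6 u room
    p = proj₁ framed
    pair : ∀ {i j} → i ≢ j → Unique (p i ∷ p j ∷ R)
    pair = proj₂ framed
    a b : Fin 6
    a = # 0
    b = # 1
    c : Fin 4 → Fin 6
    c i = suc (suc i)
    word : ∀ i → ∃ λ x → NonZero x × VanishesOn (p (c i) ∷ R) x × x (p a) ≡ false
    -- There are 2(|R| + 1) + 1 = n - 1 equations in n unknowns.
    word i = vanishing-word-at (p a) (p (c i) ∷ R) (begin
      2 + 2 * (1 + length R) ≡⟨ *-suc 2 (1 + length R) ⟨
      2 * (2 + length R)     ≡⟨ n≡ ⟨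
      n                      ∎)
    w : Fin 4 → Vector n
    w i = proj₁ (word i)
    w⊥ : ∀ i → VanishesOn (p (c i) ∷ R) (w i)
    w⊥ i = proj₁ (proj₂ (proj₂ (word i)))
    w⊥R : ∀ i → VanishesOn R (w i)
    w⊥R i = All.tail (w⊥ i)
    w≢𝟎 : ∀ i {k} → k ≢ c i → letter (w i) (p k) ≢ 𝟎
    w≢𝟎 i k≢ = nonvanishing (pair k≢) (proj₁ (proj₂ (word i))) (w⊥ i) n≤
    at-a : ∀ i → letter (w i) (p a) ≡ (false , true)
    at-a i = second-nonzero _ (w≢𝟎 i λ ()) (proj₂ (proj₂ (proj₂ (word i))))
    collision = four-nonzero-letters (λ i → letter (w i) (p b)) (λ i → w≢𝟎 i λ ())
    i = proj₁ collision
    j = proj₁ (proj₂ collision)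
    i≢j = proj₁ (proj₂ (proj₂ collision))
    at-b = proj₂ (proj₂ (proj₂ collision))
    -- At `p (c i)` the word `w i` vanishes by choice, while `w j` already has all the zeros it can
    -- have.
    distinct : letter (w i) (p (c i)) ≢ letter (w j) (p (c i))
    distinct eq = w≢𝟎 j (i≢j ∘ suc-injective ∘ suc-injective) (trans (sym eq) (All.head (w⊥ i)))

  -- The odd case n = 2m + 1, with m = k + 1

  module Odd (k : ℕ) (n≡ : n ≡ suc (2 * suc k)) (2≤k : 2 ≤ k) where

    n≤ : n ≤ 2 * suc (suc k)
    n≤ = ≤-trans (≤-reflexive n≡) (≤-trans (m≤n+m _ 1) (≤-reflexive (sym (*-suc 2 (suc k)))))

    total : ∀ {l} → l ≡ suc k → suc (suc k) + l ≡ n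
    total refl = trans (cong (λ l → suc (suc k + l)) (sym (+-identityʳ (suc k)))) (sym n≡)

    -- A nonzero word with as many zeros as heaviness permits, namely m; its zero set is then
    -- exactly `R`.
    record Light (R : List (Fin n)) (x : Vector n) : Set where
      constructor light
      field
        unique    : Unique R
        length-R  : length R ≡ suc k
        non-zero  : NonZero x
        vanishing : VanishesOn R x
    open Light

    abstract

      light-word : ∀ {R} → Unique R → length R ≡ suc k → ∃ (Light R)
      light-word {R} u len with vanishing-word R (≤-reflexive (trans (cong (λ l → suc (2 * l)) len) (sym n≡)))
      ... | x , x≢0 , x⊥R = x , light u len x≢0 x⊥R

    light-nonvanishing : ∀ {R x v} → Light R x → v ∉ R → letter x v ≢ 𝟎
    light-nonvanishing (light u len x≢0 x⊥R) v∉R =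
      nonvanishing (unique-∷ v∉R u) x≢0 x⊥R (subst (λ l → n ≤ 2 * suc l) (sym len) n≤)

    -- The m zeros bound the weight above by m + 1, and 2m < n < 2 `wt x` bounds it below by the
    -- same number.
    light-weight : ∀ {R x} → Light R x → wt x ≡ suc (suc k)
    light-weight {R} {x} (light u len x≢0 x⊥R) = ≤-antisym
      (+-cancelʳ-≤ (suc k) (wt x) (suc (suc k)) (begin
        wt x + suc k           ≡⟨ cong (wt x +_) len ⟨
        wt x + length R        ≤⟨ wt+length≤n u x⊥R ⟩
        n                      ≡⟨ total refl ⟨
        suc (suc k) + suc k    ∎))
      (*-cancelˡ-< 2 (suc k) (wt x) (begin-strict
        2 * suc k              <⟨ ≤-reflexive (sym n≡) ⟩
        n                      <⟨ heavy x x≢0 ⟩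
        2 * wt x               ∎))
      where open ≤-Reasoning

    light-parity : ∀ {R x} → Light R x → parity x ≡ odd (suc (suc k))
    light-parity {x = x} lx =
      trans (sym (odd-natSum (λ v → nonzero (letter x v)))) (cong odd (light-weight lx))

    k≤n : k ≤ n
    k≤n = ≤-trans (m≤n+m k 2) (≤-trans (m≤m+n _ _) (≤-reflexive (sym n≡)))

    abstract

      -- The complement of a k-set has k + 3 vertices, which is at least five for k ≥ 2.
      room : ∀ {R : List (Fin n)} → length R ≡ k → 5 + length R ≤ n
      room refl = begin
        5 + k               ≡⟨ cong (3 +_) (+-comm 2 k) ⟩
        3 + (k + 2)         ≤⟨ +-monoʳ-≤ (3 + k) 2≤k ⟩
        3 + (k + k)         ≡⟨ double k ⟩
        suc (2 * suc k)     ≡⟨ n≡ ⟨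
        n                   ∎
        where
        open ≤-Reasoning
        double : ∀ l → 3 + (l + l) ≡ suc (2 * suc l)
        double = solve-∀

    -- For an (m - 1)-set `R`: vertices `a` and `c i` outside it, and for each i a light word `w i`
    -- with zero set `c i ∷ R`.
    module Frame {R : List (Fin n)} (u : Unique R) (len : length R ≡ k) where

      framed = frame 5 u (room {R} len)

      a : Fin n
      a = proj₁ framed zero

      c : Fin 4 → Fin n
      c i = proj₁ framed (suc i)

      c∉ : ∀ {i j} → i ≢ j → c i ∉ c j ∷ R
      c∉ i≢j = Unique[x∷xs]⇒x∉xs (proj₂ framed (i≢j ∘ suc-injective))

      a∉ : ∀ i → a ∉ c i ∷ R
      a∉ i = Unique[x∷xs]⇒x∉xs (proj₂ framed {zero} {suc i} λ ())

      a∉R : a ∉ R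
      a∉R = a∉ zero ∘ there

      unique-c∷R : ∀ i → Unique (c i ∷ R)
      unique-c∷R i = tail (proj₂ framed {zero} {suc i} λ ())

      w : Fin 4 → Vector n
      w i = proj₁ (light-word (unique-c∷R i) (cong suc len))

      w-light : ∀ i → Light (c i ∷ R) (w i)
      w-light i = proj₂ (light-word (unique-c∷R i) (cong suc len))

      w⊥ : ∀ i → VanishesOn (c i ∷ R) (w i)
      w⊥ i = vanishing (w-light i)

      w⊥R : ∀ i → VanishesOn R (w i)
      w⊥R i = All.tail (w⊥ i)

      w-at-a : ∀ i → letter (w i) a ≢ 𝟎
      w-at-a i = light-nonvanishing (w-light i) (a∉ i)

      w-distinct : ∀ {i j} → i ≢ j → NonZero (w i ⊞ w j)
      w-distinct {i} {j} i≢j = letters-differ (w i) (w j) λ eq →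
        light-nonvanishing (w-light j) (c∉ i≢j) (trans (sym eq) (All.head (w⊥ i)))

      -- Adding gives up the zeros at `c i` and `c j` but gains one at `a`, so there are again m
      -- zeros.
      sum-light : ∀ {i j} → i ≢ j → letter (w i) a ≡ letter (w j) a → Light (a ∷ R) (w i ⊞ w j)
      sum-light {i} {j} i≢j eq = light (unique-∷ a∉R u) (cong suc len) (w-distinct i≢j)
        (letters-agree (w i) (w j) eq ∷ vanishes-⊞ (w i) (w j) (w⊥R i) (w⊥R j))

    -- Two light words and their sum, itself light, all have the parity of m + 1; additivity makes
    -- that parity zero.
    light-even : odd (suc (suc k)) ≡ false
    light-even with distinct-vertices k k≤n
    ... | R , len , u with four-nonzero-letters (λ i → letter (w i) a) w-at-a
      where open Frame u len
    ... | i , j , i≢j , eq = begin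
      odd (suc (suc k))               ≡⟨ light-parity (sum-light i≢j eq) ⟨
      parity (w i ⊞ w j)              ≡⟨ parity-⊞ (w i) (w j) ⟩
      parity (w i) xor parity (w j)   ≡⟨ ≡⇒xor (trans (light-parity (w-light i)) (sym (light-parity (w-light j)))) ⟩
      false                           ∎
      where
      open Frame u len
      open ≡-Reasoning

    -- For b outside R, a light word supported on R and b commutes with x and y
    -- at b by self-orthogonality, so x and y have the same letter there.
    light-unique : ∀ {R x y} → Light R x → Light R y → ¬ NonZero (x ⊞ y)
    light-unique {R} {x} {y} lx@(light u len _ x⊥R) ly x⊞y≢0
      with extend (suc (suc k)) u (≤-reflexive (total len))
    ... | [] , () , _
    ... | b ∷ O , len-E , u′ with light-word {O} (unique-++⁻ˡ O (tail u′)) (cong pred len-E)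
    ... | z , lz = light-nonvanishing (light u len x⊞y≢0 (vanishes-⊞ x y x⊥R (vanishing ly))) b∉R
            (letters-agree x y (trans (at-b lx) (sym (at-b ly))))
      where
      b∉ : b ∉ O ++ R
      b∉ = Unique[x∷xs]⇒x∉xs u′
      b∉R : b ∉ R
      b∉R = b∉ ∘ ∈-++⁺ʳ O
      all : ∀ v → v ∈ b ∷ O ++ R
      all = unique-complete u′ (≤-reflexive (sym
        (trans (length-++ (b ∷ O)) (trans (cong (_+ length R) len-E) (total len)))))
      at-b : ∀ {x} → Light R x → letter x b ≡ letter z b
      at-b {x} lx = commuting⇒≡ (letter x b) (letter z b)
        (trans (sym (xorSum-single _ b off)) (self-orthogonal x z))
        (light-nonvanishing lx b∉R) (light-nonvanishing lz (b∉ ∘ ∈-++⁺ˡ))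
        where
        off : ∀ v → v ≢ b → ω (letter x v) (letter z v) ≡ false
        off v v≢b with all v
        ... | here v≡b = contradiction v≡b v≢b
        ... | there v∈ with ∈-++⁻ O v∈
        ... | inj₁ v∈O = trans (cong (ω (letter x v)) (All.lookup (vanishing lz) v∈O)) (ω-𝟎ʳ (letter x v))
        ... | inj₂ v∈R = cong (λ p → ω p (letter z v)) (All.lookup (vanishing lx) v∈R)

    even-light : ∀ {R x} → Light R x → parity x ≡ false
    even-light lx = trans (light-parity lx) light-even

    module _ {R : List (Fin n)} (u : Unique R) (len : length R ≡ k) where

      open Frame u len

      -- If the words 0, 1 and 2 agreed at `a`, then `w 0 ⊞ w 1` and `w 0 ⊞ w 2` would be light with
      -- the same zero set, hence equal. Cancelling `w 0` at `c 1` would make `w 2` vanish there.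
      pair-differs : ∃₂ λ i j → i ≢ j × letter (w i) a ≢ letter (w j) a
      pair-differs with letter (w (# 0)) a ≟ₗ letter (w (# 1)) a | letter (w (# 0)) a ≟ₗ letter (w (# 2)) a
      ... | no ≢₁  | _      = # 0 , # 1 , (λ ()) , ≢₁
      ... | yes _  | no ≢₂  = # 0 , # 2 , (λ ()) , ≢₂
      ... | yes eq | yes eq′ = ⊥-elim (light-unique (sum-light (λ ()) eq) (sum-light (λ ()) eq′)
        (letters-differ (w (# 0) ⊞ w (# 1)) (w (# 0) ⊞ w (# 2)) λ agree → light-nonvanishing (w-light (# 2)) (c∉ {# 1} λ ())
          (trans (sym (⊕-cancelˡ (letter (w (# 0)) (c (# 1))) _ _
            (trans (sym (letter-⊞ (w (# 0)) (w (# 1)) _)) (trans agree (letter-⊞ (w (# 0)) (w (# 2)) _)))))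
            (All.head (w⊥ (# 1))))))

      -- Two distinct nonzero letters at `a` form a basis of the letters, so sums of two even words
      -- realise every letter.
      even-word-at : ∀ r → ∃ λ x → VanishesOn R x × letter x a ≡ r × parity x ≡ false
      even-word-at r with pair-differs
      ... | i , j , i≢j , differ with spanning _ _ (w-at-a i) (w-at-a j) differ r
      -- `w i ⊞ w i` serves as the zero word.
      ... | inj₁ r≡ = w i ⊞ w i , vanishes-⊞ (w i) (w i) (w⊥R i) (w⊥R i) , trans (letters-agree (w i) (w i) refl) (sym r≡) ,
              trans (parity-⊞ (w i) (w i)) (𝔹.xor-same (parity (w i)))
      ... | inj₂ (inj₁ r≡) = w i , w⊥R i , sym r≡ , even-light (w-light i)
      ... | inj₂ (inj₂ (inj₁ r≡)) = w j , w⊥R j , sym r≡ , even-light (w-light j)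
      ... | inj₂ (inj₂ (inj₂ r≡)) = w i ⊞ w j , vanishes-⊞ (w i) (w j) (w⊥R i) (w⊥R j) ,
              trans (letter-⊞ (w i) (w j) a) (sym r≡) ,
              trans (parity-⊞ (w i) (w j)) (cong₂ _xor_ (even-light (w-light i)) (even-light (w-light j)))

    -- Induction on the number d of zeros still missing from m: adding an even word that matches x
    -- at a new vertex gains a zero and keeps the parity.
    all-even : ∀ d {R x} → Unique R → d + length R ≡ suc k → VanishesOn R x → parity x ≡ false
    all-even zero {x = x} u len x⊥R with nonZero? x
    ... | yes x≢0 = even-light (light u len x≢0 x⊥R)
    ... | no  x≡0 = parity-zero x≡0
    -- `E` pads `R` to m - 1 vertices so that an even word y exists. As x may be nonzero on `E`,
    -- only the zeros on `R` and the new one at `a` are kept for the sum.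
    all-even (suc d) {R} {x} u len x⊥R with extend d u (≤-trans (≤-reflexive (cong pred len)) k≤n)
    ... | E , refl , u′ = begin
      parity x                  ≡⟨ 𝔹.xor-identityʳ (parity x) ⟨
      parity x xor false        ≡⟨ cong (parity x xor_) y-even ⟨
      parity x xor parity y     ≡⟨ parity-⊞ x y ⟨
      parity (x ⊞ y)            ≡⟨ all-even d (unique-∷ (a∉R ∘ ∈-++⁺ʳ E) u)
                                     (trans (+-suc d (length R)) len)
                                     (letters-agree x y (sym y≡x) ∷ vanishes-⊞ x y x⊥R (++⁻ʳ E y⊥ER)) ⟩
      false                     ∎
      where
      open ≡-Reasoning
      len′ : length (E ++ R) ≡ k
      len′ = trans (length-++ E) (cong pred len)
      open Frame u′ len′ using (a; a∉R)
      even-word = even-word-at u′ len′ (letter x a)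
      y = proj₁ even-word
      y⊥ER = proj₁ (proj₂ even-word)
      y≡x = proj₁ (proj₂ (proj₂ even-word))
      y-even = proj₂ (proj₂ (proj₂ even-word))

    impossible : ⊥
    impossible = contradiction (trans (sym full) (all-even (suc k) [] (+-identityʳ (suc k)) [])) λ ()
      where
      open ≡-Reasoning
      -- Every letter of this word has first coordinate 1, so its weight is n.
      full : parity (λ _ → true) ≡ true
      full = begin
        xorSum {n} (λ _ → true) ≡⟨ xorSum-true n ⟩
        odd n                 ≡⟨ cong odd n≡ ⟩
        not (odd (2 * suc k)) ≡⟨ cong not (odd-double (suc k)) ⟩
        true                  ∎

-- Words and transverse circuits

module Circuits {n : ℕ} (G : Graph n) where

  open Code G

  wt-cong : ∀ {x y} → x ≗ y → wt x ≡ wt y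
  wt-cong x≗y = natSum-cong (λ v → cong (bit ∘ nonzero) (letter-cong x≗y v))

  -- Exhaustive search over GF(2)^n. It makes the argument by contradiction constructive and drives
  -- the descent to a lightest word.
  word-of-weight? : {Q : ℕ → Set} → Decidable Q → Dec (∃ λ x → NonZero x × Q (wt x))
  word-of-weight? {Q} Q? = map′
    (λ (s , s≢0 , q) → Vec.lookup s , s≢0 , q)
    (λ (x , (v , ≢𝟎) , q) → let x≗ = λ w → sym (Vec.lookup∘tabulate x w) in
      Vec.tabulate x , (v , ≢𝟎 ∘ trans (letter-cong x≗ v)) , subst Q (wt-cong x≗) q)
    (anySubset? λ s → nonZero? (Vec.lookup s) ×-dec Q? (wt (Vec.lookup s)))

  lightest-word : ∀ x → Acc _<_ (wt x) → NonZero x →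
    ∃ λ y → NonZero y × wt y ≤ wt x × (∀ z → NonZero z → wt y ≤ wt z)
  lightest-word x (acc rec) x≢0 with word-of-weight? (_<? wt x)
  ... | no none = x , x≢0 , ≤-refl , λ z z≢0 → ≮⇒≥ λ z<x → none (z , z≢0 , z<x)
  ... | yes (z , z≢0 , z<x) with lightest-word z (rec z<x) z≢0
  ... | y , y≢0 , y≤z , minimal = y , y≢0 , ≤-trans y≤z (<⇒≤ z<x) , minimal

  -- The first coordinate tells whether the triple contributes its column of A, the second whether
  -- it contributes its unit vector; ψ contributes both.
  elements : Letter → Kind → Bool
  elements (a , b) φ = not a ∧ b
  elements (a , b) χ = a ∧ not b
  elements (a , b) ψ = a ∧ b

  toSet : Vector n → ElemSet n
  toSet x v = elements (letter x v)

  -- The inverse of elements on subsets of a triple with at most one element.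
  toLetter : (Kind → Bool) → Letter
  toLetter s = s χ xor s ψ , s φ xor s ψ

  toLetter-elements : ∀ p → toLetter (elements p) ≡ p
  toLetter-elements = from-yes (allLetters? λ p → toLetter (elements p) ≟ₗ p)

  toVector : ElemSet n → Vector n
  toVector S v = proj₁ (toLetter (S v))

  -- Each column splits into an A-part and an I-part; in row w the I-part comes only from the triple
  -- of w.
  colSum-letters : ∀ S w → colSum G S w ≡ w · toVector S xor proj₂ (toLetter (S w))
  colSum-letters S w = begin
    colSum G S w
      ≡⟨ xorSum-cong (λ v → regroup (S v φ) (S v χ) (S v ψ) (adj G w v) (isYes (w ≟ v))) ⟩
    xorSum (λ v → (toVector S v ∧ adj G w v) xor (isYes (w ≟ v) ∧ proj₂ (toLetter (S v))))
      ≡⟨ xorSum-xor (λ v → toVector S v ∧ adj G w v) _ ⟩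
    w · toVector S xor xorSum (λ v → isYes (w ≟ v) ∧ proj₂ (toLetter (S v)))
      ≡⟨ cong (w · toVector S xor_) (trans (xorSum-single _ w off) on) ⟩
    w · toVector S xor proj₂ (toLetter (S w)) ∎
    where
    open ≡-Reasoning
    regroup : ∀ f c p m d →
      (f ∧ d) xor ((c ∧ m) xor (p ∧ (m xor d))) ≡ ((c xor p) ∧ m) xor (d ∧ (f xor p))
    regroup = solve 5 (λ f c p m d →
      (f :* d) :+ ((c :* m) :+ (p :* (m :+ d))) := ((c :+ p) :* m) :+ (d :* (f :+ p))) refl
      where open xor-∧-Solver
    off : ∀ v → v ≢ w → isYes (w ≟ v) ∧ proj₂ (toLetter (S v)) ≡ false
    off v v≢w with w ≟ v
    ... | yes w≡v = contradiction (sym w≡v) v≢w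
    ... | no  _   = refl
    on : isYes (w ≟ w) ∧ proj₂ (toLetter (S w)) ≡ proj₂ (toLetter (S w))
    on with w ≟ w
    ... | yes _   = refl
    ... | no  w≢w = contradiction refl w≢w

  toVector-toSet : ∀ x → toVector (toSet x) ≗ x
  toVector-toSet x v = cong proj₁ (toLetter-elements (letter x v))

  colSum-toSet : ∀ x w → colSum G (toSet x) w ≡ false
  colSum-toSet x w = trans (colSum-letters (toSet x) w) (≡⇒xor (trans
    (cong proj₂ (letter-cong (toVector-toSet x) w))
    (sym (cong proj₂ (toLetter-elements (letter x w))))))

  letter-toVector : ∀ S → (∀ w → colSum G S w ≡ false) → ∀ v → letter (toVector S) v ≡ toLetter (S v)
  letter-toVector S S≡0 v = cong (toVector S v ,_) (xor≡false (trans (sym (colSum-letters S v)) (S≡0 v)))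
    where
    xor≡false : ∀ {a b} → a xor b ≡ false → a ≡ b
    xor≡false {false} eq = sym eq
    xor≡false {true} {true} eq = refl

  size-toSet : ∀ x → size (toSet x) ≡ wt x
  size-toSet x = natSum-cong (λ v → count (letter x v))
    where
    count : ∀ p → bit (elements p φ) + (bit (elements p χ) + bit (elements p ψ)) ≡ bit (nonzero p)
    count (false , false) = refl
    count (false , true)  = refl
    count (true  , false) = refl
    count (true  , true)  = refl

  -- The value φ at `𝟎` is a default that completes the set of a word to a transversal.
  kind : Letter → Kind
  kind (false , _)     = φ
  kind (true  , false) = χ
  kind (true  , true)  = ψ

  elements⇒kind : ∀ p k → elements p k ≡ true → k ≡ kind p
  elements⇒kind (false , true)  φ _ = refl
  elements⇒kind (true  , false) χ _ = refl
  elements⇒kind (true  , true)  ψ _ = refl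

  _≟ₖ_ : DecidableEquality Kind
  φ ≟ₖ φ = yes refl
  φ ≟ₖ χ = no λ ()
  φ ≟ₖ ψ = no λ ()
  χ ≟ₖ φ = no λ ()
  χ ≟ₖ χ = yes refl
  χ ≟ₖ ψ = no λ ()
  ψ ≟ₖ φ = no λ ()
  ψ ≟ₖ χ = no λ ()
  ψ ≟ₖ ψ = yes refl

  elements⇒nonzero : ∀ p k → elements p k ≡ true → nonzero p ≡ true
  elements⇒nonzero (true  , _)    _ _ = refl
  elements⇒nonzero (false , true) _ _ = refl
  elements⇒nonzero 𝟎 φ ()
  elements⇒nonzero 𝟎 χ ()
  elements⇒nonzero 𝟎 ψ ()

  elements-kind : ∀ p → p ≢ 𝟎 → elements p (kind p) ≡ true
  elements-kind = from-yes (allLetters? λ p → ¬? (p ≟ₗ 𝟎) →-dec elements p (kind p) 𝔹.≟ true)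

  toLetter-empty : ∀ {s} → (∀ k → s k ≡ false) → toLetter s ≡ 𝟎
  toLetter-empty {s} empty rewrite empty φ | empty χ | empty ψ = refl

  -- A full triple also has letter `𝟎`, since its three columns sum to zero; lying inside
  -- `elements p` excludes this.
  subset-nonzero : ∀ {s} p → (∀ k → s k ≡ true → elements p k ≡ true) → ∀ k → s k ≡ true → toLetter s ≢ 𝟎
  subset-nonzero {s} p sub k sk =
    cases p sub (subst (λ k → s k ≡ true) (elements⇒kind p k (sub k sk)) sk)
    where
    cases : ∀ p → (∀ k → s k ≡ true → elements p k ≡ true) → s (kind p) ≡ true → toLetter s ≢ 𝟎
    cases (false , b) sub sk eq with s ψ | sub ψ
    ... | false | _ = contradiction (trans (sym (trans (𝔹.xor-identityʳ (s φ)) sk)) (cong proj₂ eq)) λ ()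
    ... | true  | ψ∈ = contradiction (ψ∈ refl) λ ()
    cases (true , false) sub sk eq with s ψ | sub ψ
    ... | false | _ = contradiction (trans (sym (trans (𝔹.xor-identityʳ (s χ)) sk)) (cong proj₁ eq)) λ ()
    ... | true  | ψ∈ = contradiction (ψ∈ refl) λ ()
    cases (true , true) sub sk eq with s φ | sub φ
    ... | false | _ = contradiction (trans (sym sk) (cong proj₂ eq)) λ ()
    ... | true  | φ∈ = contradiction (φ∈ refl) λ ()

  subset-bit-≤ : ∀ {s} p → (∀ k → s k ≡ true → elements p k ≡ true) → bit (nonzero (toLetter s)) ≤ bit (nonzero p)
  subset-bit-≤ {s} p sub with p ≟ₗ 𝟎
  ... | yes refl = ≤-reflexive (cong (bit ∘ nonzero) (toLetter-empty {s} λ k → 𝔹.¬-not λ sk → contradiction (sub k sk) (empty k)))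
    where
    empty : ∀ k → elements 𝟎 k ≢ true
    empty φ ()
    empty χ ()
    empty ψ ()
  ... | no p≢𝟎 = ≤-trans (bit≤1 (nonzero (toLetter s))) (≤-reflexive (cong bit (sym (nonzero-true p p≢𝟎))))
    where
    bit≤1 : ∀ b → bit b ≤ 1
    bit≤1 false = z≤n
    bit≤1 true  = ≤-refl

  -- A dependency inside a proper subset yields a nonzero word whose support lies in that of x and
  -- misses a vertex, hence a lighter word.
  lightest⇒circuit : ∀ x → NonZero x → (∀ y → NonZero y → wt x ≤ wt y) → Circuit G (toSet x)
  lightest⇒circuit x (v , x≢𝟎) lightest =
    (toSet x , (λ _ _ → id) , (v , kind (letter x v) , elements-kind (letter x v) x≢𝟎) , colSum-toSet x) , minimal
    where
    minimal : ∀ D → D ⊂ toSet x → ¬ Dependent G D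
    minimal D (D⊆C , v₀ , k₀ , ∈C , ∉D) (T , T⊆D , (v₁ , k₁ , ∈T) , T≡0) =
      <-irrefl refl (≤-<-trans (lightest y (v₁ , y≢𝟎)) (natSum-mono-< bit-≤ v₀ bit-<))
      where
      y = toVector T
      T⊆C : ∀ v k → T v k ≡ true → elements (letter x v) k ≡ true
      T⊆C v k = D⊆C v k ∘ T⊆D v k
      letter-y : ∀ v → letter y v ≡ toLetter (T v)
      letter-y = letter-toVector T T≡0
      y≢𝟎 : letter y v₁ ≢ 𝟎
      y≢𝟎 = subset-nonzero {T v₁} (letter x v₁) (T⊆C v₁) k₁ ∈T ∘ trans (sym (letter-y v₁))
      bit-≤ : ∀ v → bit (nonzero (letter y v)) ≤ bit (nonzero (letter x v))
      bit-≤ v = ≤-trans (≤-reflexive (cong (bit ∘ nonzero) (letter-y v))) (subset-bit-≤ {T v} (letter x v) (T⊆C v))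
      -- The only element of the circuit in the triple of `v₀` is `k₀`, which `D` omits.
      T-empty : ∀ k → T v₀ k ≡ false
      T-empty k = 𝔹.¬-not λ ∈T → contradiction
        (trans (sym ∉D) (subst (λ k → D v₀ k ≡ true)
          (trans (elements⇒kind (letter x v₀) k (T⊆C v₀ k ∈T)) (sym (elements⇒kind (letter x v₀) k₀ ∈C)))
          (T⊆D v₀ k ∈T))) λ ()
      bit-< : bit (nonzero (letter y v₀)) < bit (nonzero (letter x v₀))
      bit-< = ≤-trans
        (s≤s (≤-reflexive (cong (bit ∘ nonzero) (trans (letter-y v₀) (toLetter-empty {T v₀} T-empty)))))
        (≤-reflexive (cong bit (sym (elements⇒nonzero (letter x v₀) k₀ ∈C))))

  transverse : ∀ x → ∃ λ T → Transversal T × toSet x ⊆ T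
  transverse x = (λ v k → isYes (k ≟ₖ kind (letter x v))) ,
    (λ v → kind (letter x v) , on v , λ k → off v k) ,
    λ v k ∈x → subst (λ k′ → isYes (k′ ≟ₖ kind (letter x v)) ≡ true) (sym (elements⇒kind (letter x v) k ∈x)) (on v)
    where
    on : ∀ v → isYes (kind (letter x v) ≟ₖ kind (letter x v)) ≡ true
    on v with kind (letter x v)
    ... | φ = refl
    ... | χ = refl
    ... | ψ = refl
    off : ∀ v k → isYes (k ≟ₖ kind (letter x v)) ≡ true → k ≡ kind (letter x v)
    off v k eq with k ≟ₖ kind (letter x v)
    ... | yes k≡ = k≡

-- Existence of a word of weight at most n/2 and of the resulting circuit

short-word : ∀ n → 7 ≤ n → (G : Graph n) →
  ∃ λ x → Code.NonZero G x × 2 * Code.wt G x ≤ n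
short-word n 7≤n G with Circuits.word-of-weight? G (λ w → 2 * w ≤? n)
... | yes found = found
... | no ¬found = ⊥-elim (by-parity (even-or-odd n))
  where
  heavy : ∀ x → Code.NonZero G x → n < 2 * Code.wt G x
  heavy x x≢0 = ≰⇒> λ ≤n → ¬found (x , x≢0 , ≤n)
  open Heavy G heavy
  by-parity : (∃ λ m → n ≡ 2 * m) ⊎ (∃ λ m → n ≡ suc (2 * m)) → ⊥
  -- Here 2m ≥ 7 gives m ≥ 4, so R has m - 2 ≥ 2 vertices.
  by-parity (inj₁ (m , n≡)) with *-cancelˡ-< 2 3 m (≤-trans 7≤n (≤-reflexive n≡))
  ... | s≤s (s≤s 2≤k) with distinct-vertices _ (≤-trans (m≤n+m _ 2) (≤-trans (m≤m+n m _) (≤-reflexive (sym n≡))))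
  ... | R , refl , u = even-impossible u n≡ 2≤k
  -- Here 2m + 1 ≥ 7 gives m ≥ 3, so k = m - 1 ≥ 2.
  by-parity (inj₂ (m , n≡)) with *-cancelˡ-≤ {3} {m} 2 (s≤s⁻¹ (≤-trans 7≤n (≤-reflexive n≡)))
  ... | s≤s 2≤k = Odd.impossible _ n≡ 2≤k

theorem38 : (n : ℕ) → 7 ≤ n → (G : Graph n) →
    ∃ λ (C : ElemSet n) → TransverseCircuit G C × 2 * size C ≤ n
theorem38 n 7≤n G with short-word n 7≤n G
... | x , x≢0 , 2x≤n with Circuits.lightest-word G x (<-wellFounded _) x≢0
... | y , y≢0 , y≤x , lightest = toSet y , (lightest⇒circuit y y≢0 lightest , transverse y) ,
  ≤-trans (*-monoʳ-≤ 2 (≤-trans (≤-reflexive (size-toSet y)) y≤x)) 2x≤n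
  where open Circuits G
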